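{- The number of distinct quartics in an $n \times n$ array is $\mathcal{O}(n^2 \log^2 n)$.
   Context: For an array $W$ and positive integers $\alpha,\beta$, $W^{\alpha,\beta}$ denotes the array composed of $\alpha\times\beta$ copies of $W$ ($\alpha$ copies vertically, $\beta$ horizontally). A quartic is an array of the form $V^{2,2}$ for an arbitrary (not necessarily primitive) array $V$. The distinct quartics of an array $A$ are the distinct (by content) subarrays of $A$ that are quartics; occurrences at different positions with the same content count once. -}

module Defs where

open import Data.Nat using (ℕ; _+_; _*_; _<_; _≤_)
open import Data.Product using (_×_)
open import Relation.Binary.PropositionalEquality using (_≡_)

-- An array over alphabet Σ is given by its entry function; an n×n array
-- uses only the entries at (r , c) with r < n and c < n (0-based).
Array : Set → Set
Array Σ = ℕ → ℕ → Σ

-- An occurrence of a candidate quartic V^{2,2}: top-left corner (row , col),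
-- V has size p × q, so the occurrence has size 2p × 2q.
record Occ : Set where
  constructor occ
  field
    row col p q : ℕ
open Occ public

IsQuarticOcc : {Σ : Set} → ℕ → Array Σ → Occ → Set
IsQuarticOcc n A (occ i j p q) =
  (1 ≤ p) × (1 ≤ q) × (i + (p + p) ≤ n) × (j + (q + q) ≤ n) ×
  (∀ a b → a < p → b < q →
     (A (i + a) (j + b) ≡ A (i + p + a) (j + b)) ×
     (A (i + a) (j + b) ≡ A (i + a) (j + q + b)) ×
     (A (i + a) (j + b) ≡ A (i + p + a) (j + q + b)))

SameContent : {Σ : Set} → Array Σ → Occ → Occ → Set
SameContent A (occ i j p q) (occ i' j' p' q') =
  (p ≡ p') × (q ≡ q') ×
  (∀ a b → a < p + p → b < q + q → A (i + a) (j + b) ≡ A (i' + a) (j' + b))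

{-# OPTIONS --safe #-}
module Submission where

-- Write a quartic as W^{2α,2β} with W primitive. For a fixed W, the shapes (α , β)
-- that occur are no more numerous than the occurrences of W^{2,2}: going through the
-- values of α in increasing order, the widest occurrence of W^{2α,2β} has starts of
-- W^{2,2} in at least α rows of the array, at least one of which was not used for a
-- smaller α, and that row provides β of them. So it suffices to count occurrences of
-- W^{2,2} with W primitive. At a given corner, the three squares lemma, applied to
-- the string of rows, and to the string of columns, of a strip common to three such
-- blocks, leaves at most two heights and two widths of W in each of the ⌈log₂ n⌉²
-- dyadic classes.

open import Defs
open import Data.Nat using (ℕ; _+_; _*_; _≤_)
open import Data.Nat.Logarithm using (⌈log₂_⌉)
open import Data.List using (List; length)
open import Data.List.Relation.Unary.All using (All)
open import Data.List.Relation.Unary.AllPairs using (AllPairs)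
open import Data.Product using (Σ-syntax; ∃-syntax)
open import Relation.Nullary using (¬_)
open import Data.Nat using (zero; suc; _∸_; _<_; z≤n; s≤s; >-nonZero; _≤?_; _<?_; less; equal; greater; compare; _≟_)
open import Data.Nat.Properties
open import Data.Nat.Divisibility using (_∣_; divides; ∣-refl; ∣-trans; ∣⇒≤; ∣m∣n⇒∣m+n; ∣m+n∣m⇒∣n)
open import Data.Nat.DivMod using (_/_; _%_; m≡m%n+[m/n]*n; m%n<n)
open import Data.Nat.Tactic.RingSolver using (solve-∀)
open import Data.Product using (_×_; _,_; ∃₂; proj₁; proj₂)
open import Function using (_∘_; flip)
open import Relation.Nullary using (Dec; yes; no; contradiction; ¬?)
open import Relation.Binary using (IsEquivalence)
open import Relation.Binary.PropositionalEquality using (_≡_; _≢_; refl; sym; trans; cong; cong₂; subst; subst₂)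
open import Data.List using ([]; _∷_; applyUpTo; _++_; map)
open import Data.List.Properties using (length-applyUpTo; length-++; length-map)
open import Data.List.Membership.Propositional using (_∈_; _∉_; find)
open import Data.List.Membership.DecPropositional _≟_ using (_∈?_)
open import Data.List.Membership.Propositional.Properties using (∈-applyUpTo⁻)
open import Data.List.Relation.Unary.All as All using ([]; _∷_)
open import Data.List.Relation.Unary.Any using (here; there; any?)
open import Data.List.Relation.Unary.AllPairs using ([]; _∷_)
import Data.List.Relation.Unary.AllPairs.Properties as AllPairs
open import Data.List.Relation.Binary.Sublist.Propositional using (_⊆_; []; _∷_; _∷ʳ_)
open import Data.List.Relation.Binary.Sublist.Propositional.Properties using (All-resp-⊆)
open import Data.Empty using (⊥)
open import Relation.Binary.Definitions using (tri<; tri≈; tri>)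
open import Relation.Nullary.Decidable using (decidable-stable; ¬¬-excluded-middle)
open import Data.Nat.Induction using (<-wellFounded)
open import Induction.WellFounded using (Acc; acc)
open import Data.Nat.Logarithm using (⌈log₂⌉-mono-≤; ⌈log₂2*n⌉≡1+⌈log₂n⌉)
open import Data.List.Extrema.Nat using (argmax; argmax-all; f[xs]≤f[argmax])
import Data.List.Relation.Unary.All.Properties as All
open import Data.Sum using (_⊎_; inj₁; inj₂; [_,_]′)
open import Data.Unit using (⊤; tt)

-- Periods of strings, up to the three squares lemma

-- E x y means that positions x and y of the string carry equal letters; below, the
-- letters are the rows, or the columns, of a strip of the array.
Per : (ℕ → ℕ → Set) → ℕ → ℕ → Set
Per E h r = ∀ a → a + r < h → E a (a + r)

Per-mono : ∀ {E h h′ r} → h ≤ h′ → Per E h′ r → Per E h r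
Per-mono h≤h′ P a a+r<h = P a (<-≤-trans a+r<h h≤h′)

remainder : ∀ r → 1 ≤ r → ∀ a → ∃₂ λ a₀ x → a₀ < r × a ≡ a₀ + x * r
remainder r 1≤r a = a % r , a / r , m%n<n a r , m≡m%n+[m/n]*n a r
  where instance _ = >-nonZero 1≤r

divisor-pos : ∀ {d m} → 1 ≤ m → d ∣ m → 1 ≤ d
divisor-pos {zero} 1≤m (divides k eq) = contradiction (trans eq (*-zeroʳ k)) (>⇒≢ 1≤m)
divisor-pos {suc d} _ _ = s≤s z≤n

divisor-≤ : ∀ {d m} → 1 ≤ m → d ∣ m → d ≤ m
divisor-≤ 1≤m = ∣⇒≤ where instance _ = >-nonZero 1≤m

module Periods {E : ℕ → ℕ → Set} (E-equiv : IsEquivalence E) where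

  open IsEquivalence E-equiv renaming (refl to ~refl; sym to ~sym; trans to ~trans; reflexive to ~reflexive)

  Per-multiple : ∀ {h r} → Per E h r → ∀ x a → a + x * r < h → E a (a + x * r)
  Per-multiple {h} {r} P zero a _ = ~reflexive (sym (+-identityʳ a))
  Per-multiple {h} {r} P (suc x) a lt =
    subst (E a) (sym (eq a r (x * r)))
      (~trans (Per-multiple P x a (≤-<-trans (m≤m+n _ r) lt′)) (P (a + x * r) lt′))
    where
      eq : ∀ a r y → a + (r + y) ≡ a + y + r
      eq = solve-∀
      lt′ : a + x * r + r < h
      lt′ = subst (_< h) (eq a r (x * r)) lt

  -- Subtracting one multiple of `p` from both positions brings `a` below `p`, where the step by `g`
  -- stays inside the prefix of length `L`.
  Per-extend : ∀ {L h p g} → 1 ≤ p → g ∣ p → p + g ≤ L → Per E L g → Per E h p → Per E h g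
  Per-extend {L} {h} {p} {g} 1≤p g∣p p+g≤L Pg Pp a a+g<h with remainder p 1≤p a
  ... | a₀ , x , a₀<p , refl =
    ~trans (~sym (Per-multiple Pp x a₀ (≤-<-trans (m≤m+n _ g) a+g<h)))
      (~trans (Pg a₀ (<-≤-trans (+-monoˡ-< g a₀<p) p+g≤L))
        (subst (E (a₀ + g)) (eq a₀ g (x * p))
          (Per-multiple Pp x (a₀ + g) (subst (_< h) (sym (eq a₀ g (x * p))) a+g<h))))
    where
      eq : ∀ a g y → a + g + y ≡ a + y + g
      eq = solve-∀

  -- The Fine and Wilf theorem for strings of length at least `p + q`, by the subtractive Euclidean
  -- algorithm; `m` bounds `p + q` and drives the recursion.
  fine-wilf : ∀ m {p q h} → p + q ≤ m → 1 ≤ p → 1 ≤ q → p + q ≤ h →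
              Per E h p → Per E h q → ∃[ g ] g ∣ p × g ∣ q × Per E h g
  fine-wilf-< : ∀ m {p d h} → p + (p + d) ≤ suc m → 1 ≤ p → 1 ≤ d → p + (p + d) ≤ h →
              Per E h p → Per E h (p + d) → ∃[ g ] g ∣ p × g ∣ p + d × Per E h g

  fine-wilf zero p+q≤0 1≤p _ _ _ _ = contradiction (≤-trans 1≤p (≤-trans (m≤m+n _ _) p+q≤0)) λ ()
  fine-wilf (suc m) {p} {q} {h} p+q≤m 1≤p 1≤q p+q≤h Pp Pq with compare p q
  ... | equal .p = p , ∣-refl , ∣-refl , Pp
  ... | less .p k =
    let (g , g∣p , g∣q , Pg) =
          fine-wilf-< m (subst (λ z → p + z ≤ suc m) eq p+q≤m) 1≤p (s≤s z≤n)
            (subst (λ z → p + z ≤ h) eq p+q≤h) Pp (subst (Per E h) eq Pq)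
    in g , g∣p , subst (g ∣_) (sym eq) g∣q , Pg
    where
      eq : suc (p + k) ≡ p + suc k
      eq = sym (+-suc p k)
  ... | greater .q k =
    let (g , g∣q , g∣p , Pg) =
          fine-wilf-< m (subst (_≤ suc m) eq₂ p+q≤m) 1≤q (s≤s z≤n)
            (subst (_≤ h) eq₂ p+q≤h) Pq (subst (Per E h) eq Pp)
    in g , subst (g ∣_) (sym eq) g∣p , g∣q , Pg
    where
      eq : suc (q + k) ≡ q + suc k
      eq = sym (+-suc q k)
      eq₂ : suc (q + k) + q ≡ q + (q + suc k)
      eq₂ = trans (+-comm (suc (q + k)) q) (cong (q +_) eq)

  fine-wilf-< m {p} {d} {h} le 1≤p 1≤d le′ Pp Pq =
    let (g , g∣p , g∣d , Pg) = fine-wilf m (≤-pred (≤-trans (+-monoˡ-≤ (p + d) 1≤p) le)) 1≤p 1≤d ≤-refl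
                                 (Per-mono {E} (≤-trans (m≤n+m (p + d) p) le′) Pp) Pd
    in g , g∣p , ∣m∣n⇒∣m+n g∣p g∣d ,
       Per-extend 1≤p g∣p (+-monoʳ-≤ p (divisor-≤ 1≤d g∣d)) Pg Pp
    where
      eq : ∀ a p d → a + (p + d) ≡ a + d + p
      eq = solve-∀
      -- Go forward by `p + d`, then back by `p`. For `a < p` the forward step stays below `h`,
      -- hence the prefix of length `p + d`; `Per-extend` then returns to length `h`.
      Pd : Per E (p + d) d
      Pd a lt = ~trans (Pq a lt₂)
        (subst (λ z → E z (a + d)) (sym (eq a p d)) (~sym (Pp (a + d) (subst (_< h) (eq a p d) lt₂))))
        where
          lt₂ : a + (p + d) < h
          lt₂ = <-≤-trans (+-monoˡ-< (p + d) (+-cancelʳ-< d a p lt)) le′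

  Square : ℕ → Set
  Square p = Per E (p + p) p

  Square-step : ∀ {p} → Square p → ∀ {a} → a < p → E a (p + a)
  Square-step {p} S {a} a<p = subst (E a) (+-comm a p) (S a (+-monoˡ-< p a<p))

  -- Back by the first square, then forward by the second: the `p + d` letters from position `p` on
  -- have period `d`.
  Squares-difference : ∀ {p d} → Square p → Square (p + d) → ∀ {a} → a < p → E (p + a) (p + (a + d))
  Squares-difference {p} {d} S T {a} a<p =
    ~trans (~sym (Square-step S a<p))
      (subst (E a) (eq p d a) (Square-step T (<-≤-trans a<p (m≤m+n p d))))
    where
      eq : ∀ p d a → p + d + a ≡ p + (a + d)
      eq = solve-∀

shift-equiv : ∀ {E : ℕ → ℕ → Set} → IsEquivalence E → ∀ p → IsEquivalence (λ x y → E (p + x) (p + y))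
shift-equiv eqv p = record { refl = refl′ ; sym = sym′ ; trans = trans′ }
  where open IsEquivalence eqv renaming (refl to refl′; sym to sym′; trans to trans′)

module _ {E : ℕ → ℕ → Set} (E-equiv : IsEquivalence E) where

  open IsEquivalence E-equiv using () renaming (sym to ~sym; trans to ~trans)
  open Periods E-equiv

  period-below-p : ∀ {p d g} → Square p → Per (λ x y → E (p + x) (p + y)) (p + d) g → Per E p g
  period-below-p {p} {d} {g} S Pg a a+g<p =
    ~trans (Square-step S (≤-<-trans (m≤m+n a g) a+g<p))
      (~trans (Pg a (<-≤-trans a+g<p (m≤m+n p d))) (~sym (Square-step S a+g<p)))

  -- For a < p ≤ a + g, the second and third squares have lengths differing by
  -- e = g + k * g, and this period takes a + g back to a − k * g, inside the first p
  -- positions.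
  common-period : ∀ {p d g} k → 1 ≤ g → g ≤ d → d + (g + k * g) ≤ p →
    Square p → Square (p + d) → Square (p + d + (g + k * g)) →
    Per (λ x y → E (p + x) (p + y)) (p + d) g → Per E (p + p) g
  common-period {p} {d} {g} k 1≤g g≤d d+e≤p S₁ S₂ S₃ Pg a a+g<2p with p ≤? a
  ... | yes p≤a = subst₂ E eq₁ eq₂ (Pg (a ∸ p) lt)
    where
      eq₁ : p + (a ∸ p) ≡ a
      eq₁ = m+[n∸m]≡n p≤a
      eq₂ : p + (a ∸ p + g) ≡ a + g
      eq₂ = trans (sym (+-assoc p (a ∸ p) g)) (cong (_+ g) eq₁)
      lt : a ∸ p + g < p + d
      lt = <-≤-trans (+-cancelˡ-< p _ _ (subst (_< p + p) (sym eq₂) a+g<2p)) (m≤m+n p d)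
  ... | no p≰a with a + g <? p
  ...   | yes a+g<p = period-below-p S₁ Pg a a+g<p
  ...   | no a+g≮p =
    subst (λ z → E z (a + g)) eq₁
      (~trans (~sym (Per-multiple (period-below-p S₁ Pg) k c (subst (_< p) (sym eq₁) a<p)))
        (subst (E c) eq₂ Pe))
    where
      e c : ℕ
      e = g + k * g
      c = a ∸ k * g
      a<p : a < p
      a<p = ≰⇒> p≰a
      kg≤a : k * g ≤ a
      kg≤a = +-cancelˡ-≤ g _ _ (≤-trans (≤-trans (m≤n+m e d) d+e≤p) (subst (p ≤_) (+-comm a g) (≮⇒≥ a+g≮p)))
      eq₁ : c + k * g ≡ a
      eq₁ = m∸n+n≡m kg≤a
      eq₂ : c + e ≡ a + g
      eq₂ = trans (shuffle c g (k * g)) (cong (_+ g) eq₁)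
        where
          shuffle : ∀ c g y → c + (g + y) ≡ c + y + g
          shuffle = solve-∀
      c+e<p+d : c + e < p + d
      c+e<p+d = subst (_< p + d) (sym eq₂) (<-≤-trans (+-monoˡ-< g a<p) (+-monoʳ-≤ p g≤d))
      c<p+d : c < p + d
      c<p+d = ≤-<-trans (m≤m+n c e) c+e<p+d
      Pe : E c (c + e)
      Pe = ~trans (Square-step S₂ c<p+d)
             (~trans (Squares-difference S₂ S₃ c<p+d) (~sym (Square-step S₂ c+e<p+d)))

  -- A weak form of the three squares lemma. The `p + d` letters from position `p` on have periods
  -- `d` and `d + e`, hence by Fine and Wilf a period `g` dividing both. `common-period` carries `g`
  -- over to the whole first square, and Fine and Wilf applied to `g` and `p` yields a proper
  -- divisor of `p`.
  three-squares : ∀ {p d e} → 1 ≤ d → 1 ≤ e → d + e ≤ p →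
    Square p → Square (p + d) → Square (p + d + e) →
    ∃[ g ] g ∣ p × g < p × Per E (p + p) g
  three-squares {p} {d} {e} 1≤d 1≤e d+e≤p S₁ S₂ S₃
    with Periods.fine-wilf (shift-equiv E-equiv p) (d + (d + e)) {h = p + d} ≤-refl
           1≤d (≤-trans 1≤d (m≤m+n d e)) (subst (d + (d + e) ≤_) (+-comm d p) (+-monoʳ-≤ d d+e≤p))
           (λ a lt → Squares-difference S₁ S₂ (+-cancelʳ-< d a p lt))
           (λ a lt → Squares-difference S₁ (subst Square (+-assoc p d e) S₃)
                       (+-cancelʳ-< d a p (≤-<-trans (+-monoʳ-≤ a (m≤m+n d e)) lt)))
  ... | g , g∣d , g∣d+e , Pg with ∣m+n∣m⇒∣n g∣d+e g∣d
  ... | divides zero refl = contradiction 1≤e λ ()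
  -- `g` divides `d` and `d + e`, hence `e`; as `e` is positive, it has the form `g + k * g` that
  -- `common-period` expects.
  ... | divides (suc k) refl =
    let 1≤g = divisor-pos 1≤d g∣d
        g≤d = divisor-≤ 1≤d g∣d
        d<p = <-≤-trans (m<m+n d 1≤e) d+e≤p
        Pg′ = common-period k 1≤g g≤d d+e≤p S₁ S₂ S₃ Pg
        (h , h∣g , h∣p , Ph) = fine-wilf (g + p) ≤-refl 1≤g (≤-trans (s≤s z≤n) d<p)
                                 (+-monoˡ-≤ p (≤-trans g≤d (<⇒≤ d<p))) Pg′ S₁
    in h , h∣p , ≤-<-trans (divisor-≤ 1≤g h∣g) (≤-<-trans g≤d d<p) , Ph

-- Cardinality bounds by fibres

module _ {X : Set} where

  AllPairs-resp-⊆ : ∀ {R : X → X → Set} {xs ys} → ys ⊆ xs → AllPairs R xs → AllPairs R ys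
  AllPairs-resp-⊆ [] [] = []
  AllPairs-resp-⊆ (_ ∷ʳ τ) (_ ∷ rs) = AllPairs-resp-⊆ τ rs
  AllPairs-resp-⊆ (refl ∷ τ) (r ∷ rs) = All-resp-⊆ τ r ∷ AllPairs-resp-⊆ τ rs

  Split : (X → Set) → List X → Set
  Split P xs = ∃₂ λ ys zs →
    ys ⊆ xs × zs ⊆ xs × All P ys × All (¬_ ∘ P) zs × length xs ≡ length ys + length zs

  split : ∀ {P : X → Set} {xs} → All (Dec ∘ P) xs → Split P xs
  split [] = [] , [] , [] , [] , [] , [] , refl
  split {xs = x ∷ _} (yes p ∷ ds) with split ds
  ... | ys , zs , τ , υ , ps , qs , eq =
    x ∷ ys , zs , refl ∷ τ , x ∷ʳ υ , p ∷ ps , qs , cong suc eq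
  split {xs = x ∷ _} (no ¬p ∷ ds) with split ds
  ... | ys , zs , τ , υ , ps , qs , eq =
    ys , x ∷ zs , x ∷ʳ τ , refl ∷ υ , ps , ¬p ∷ qs , trans (cong suc eq) (sym (+-suc _ _))

  ¬¬-All : ∀ {P : X → Set} → (∀ x → ¬ ¬ P x) → ∀ xs → ¬ ¬ All P xs
  ¬¬-All ¬¬P [] k = k []
  ¬¬-All ¬¬P (x ∷ xs) k = ¬¬P x λ p → ¬¬-All ¬¬P xs λ ps → k (p ∷ ps)

  -- Cardinality is measured by lists with pairwise `R`-related entries, `R` being some form of
  -- distinctness; this suits predicates `P` that are not decidable.
  AtMost : (X → X → Set) → (X → Set) → ℕ → Set
  AtMost R P K = ∀ xs → AllPairs R xs → All P xs → length xs ≤ K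

  at-most-one : ∀ {R P} → (∀ {x y} → P x → P y → R x y → ⊥) → AtMost R P 1
  at-most-one _ [] _ _ = z≤n
  at-most-one _ (x ∷ []) _ _ = ≤-refl
  at-most-one clash (x ∷ y ∷ _) ((r ∷ _) ∷ _) (p ∷ q ∷ _) = contradiction r (clash p q)

  at-most-fibres : ∀ {R P K} (f : X → ℕ) N → (∀ {x} → P x → f x < N) →
    (∀ c → AtMost R (λ x → P x × f x ≡ c) K) → AtMost R P (N * K)
  at-most-fibres f zero f< _ [] _ _ = z≤n
  at-most-fibres f zero f< _ (x ∷ xs) _ (p ∷ _) = contradiction (f< p) λ ()
  at-most-fibres {P = P} {K = K} f (suc N) f< fibre xs rs ps
    with split (All.universal (λ x → f x ≟ N) xs)
  ... | ys , zs , τ , υ , eqs , neqs , len = subst (_≤ K + N * K) (sym len) (+-mono-≤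
    (fibre N ys (AllPairs-resp-⊆ τ rs) (All.zip (All-resp-⊆ τ ps , eqs)))
    (at-most-fibres {P = λ x → P x × f x ≢ N} f N
      (λ (p , ≢N) → ≤∧≢⇒< (≤-pred (f< p)) ≢N)
      (λ c ws rs ps → fibre c ws rs (All.map (λ ((p , _) , eq) → p , eq) ps))
      zs (AllPairs-resp-⊆ υ rs) (All.zip (All-resp-⊆ υ ps , neqs))))

  -- The head `x` fixes one value. Two further values, different from it and from each other, would
  -- form with it a forbidden chain in some order, so all remaining entries share a single value.
  at-most-two-values : ∀ {R P K} (f : X → ℕ) →
    (∀ {x y z} → P x → P y → P z → f x < f y → f y < f z → ⊥) →
    (∀ c → AtMost R (λ x → P x × f x ≡ c) K) → AtMost R P (2 * K)
  at-most-two-values _ _ _ [] _ _ = z≤n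
  at-most-two-values {P = P} {K} f no-three fibre xs@(x ∷ _) rs ps@(p ∷ _)
    with split (All.universal (λ y → f y ≟ f x) xs)
  ... | ys , zs , τ , υ , eqs , neqs , len = subst (_≤ 2 * K) (sym len) (+-mono-≤
    (fibre (f x) ys (AllPairs-resp-⊆ τ rs) (All.zip (All-resp-⊆ τ ps , eqs)))
    (≤-trans (rest zs (AllPairs-resp-⊆ υ rs) (All.zip (All-resp-⊆ υ ps , neqs))) (m≤m+n K 0)))
    where
      third : ∀ {y z} → P y → P z → f y ≢ f x → f z ≢ f x → f y < f z → ⊥
      third {y} {z} q r y≢x z≢x y<z with <-cmp (f y) (f x) | <-cmp (f z) (f x)
      ... | tri≈ _ y≡x _ | _ = y≢x y≡x
      ... | _ | tri≈ _ z≡x _ = z≢x z≡x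
      ... | tri> _ _ x<y | _ = no-three p q r x<y y<z
      ... | tri< y<x _ _ | tri< z<x _ _ = no-three q r p y<z z<x
      ... | tri< y<x _ _ | tri> _ _ x<z = no-three q p r y<x x<z
      same : ∀ {y z} → P y × f y ≢ f x → P z × f z ≢ f x → f z ≡ f y
      same {y} {z} (q , y≢x) (r , z≢x) with <-cmp (f y) (f z)
      ... | tri≈ _ y≡z _ = sym y≡z
      ... | tri< y<z _ _ = contradiction y<z (third q r y≢x z≢x)
      ... | tri> _ _ z<y = contradiction z<y (third r q z≢x y≢x)
      rest : AtMost _ (λ y → P y × f y ≢ f x) K
      rest [] _ _ = z≤n
      rest zs@(z ∷ _) rs qs@(q ∷ _) =
        fibre (f z) zs rs (All.map (λ r → proj₁ r , same q r) qs)

at-most-members : ∀ ys → AtMost {ℕ} _≢_ (_∈ ys) (length ys)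
at-most-members [] [] _ _ = z≤n
at-most-members [] (x ∷ xs) _ (() ∷ _)
at-most-members (y ∷ ys) xs rs ps with split (All.universal (_≟ y) xs)
... | ws , zs , τ , υ , eqs , neqs , len = subst (_≤ suc (length ys)) (sym len) (+-mono-≤
  (at-most-one (λ eq eq′ neq → neq (trans eq (sym eq′))) ws (AllPairs-resp-⊆ τ rs) eqs)
  (at-most-members ys zs (AllPairs-resp-⊆ υ rs) (All.zipWith tail (All-resp-⊆ υ ps , neqs))))
  where
    tail : ∀ {x} → x ∈ y ∷ ys × x ≢ y → x ∈ ys
    tail (here x≡y , x≢y) = contradiction x≡y x≢y
    tail (there x∈ys , _) = x∈ys

-- Pigeonhole on the `m + 1` distinct values `f 0`, ..., `f m`. It serves to find a row of the array
-- that is not yet in use.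
fresh-value : ∀ (f : ℕ → ℕ) → (∀ {x y} → x < y → f x ≢ f y) → ∀ {m} ys → length ys ≤ m →
  ∃[ x ] x ≤ m × f x ∉ ys
fresh-value f f-inj {m} ys len with any? (λ y → ¬? (y ∈? ys)) (applyUpTo f (suc m))
... | no all∈ = contradiction
  (subst (_≤ m) (length-applyUpTo f (suc m))
    (≤-trans (at-most-members ys (applyUpTo f (suc m))
      (AllPairs.applyUpTo⁺₁ f (suc m) (λ x<y _ → f-inj x<y))
      (All.map (λ {x} → decidable-stable (x ∈? ys)) (All.¬Any⇒All¬ _ all∈))) len))
  1+n≰n
... | yes some∉ with find some∉
... | y , y∈ , y∉ys with ∈-applyUpTo⁻ f y∈
... | x , x<1+m , refl = x , ≤-pred x<1+m , y∉ys

-- Blocks of an array and their primitive roots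

¬¬-least : ∀ {P : ℕ → Set} {m} → P m → ¬ ¬ (∃[ r ] P r × (∀ {h} → h < r → ¬ P h))
¬¬-least {P} {m} pm k = none m (<-wellFounded m) pm
  where
    none : ∀ r → Acc _<_ r → ¬ P r
    none r (acc rec) pr = k (r , pr , λ {h} h<r → none h (rec h<r))

-- Since `x + 2 ≤ α + 1 ≤ 2α`, a copy of W^{2,2} that starts `x` roots below the corner lies inside
-- W^{2α,2β}.
multiple-fits : ∀ {x α} → x < α → ∀ r {a} → a < r + r → a + x * r < α * r + α * r
multiple-fits {x} {α} x<α r {a} a<2r = <-≤-trans (+-monoˡ-< (x * r) a<2r)
  (subst (_≤ α * r + α * r) (eq r (x * r)) (+-mono-≤ (≤-trans (m≤m+n r (x * r)) xr) xr))
  where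
    eq : ∀ r y → r + (r + y) ≡ r + r + y
    eq = solve-∀
    xr : r + x * r ≤ α * r
    xr = *-monoˡ-≤ r x<α

module _ {Σ : Set} where

  RowEq : Array Σ → ℕ → ℕ → ℕ → ℕ → ℕ → Set
  RowEq A k l w x y = ∀ {b} → b < w → A (k + x) (l + b) ≡ A (k + y) (l + b)

  RowEq-equiv : ∀ A k l w → IsEquivalence (RowEq A k l w)
  RowEq-equiv A k l w = record
    { refl = λ _ → refl
    ; sym = λ e b<w → sym (e b<w)
    ; trans = λ e f b<w → trans (e b<w) (f b<w)
    }

  VPer : Array Σ → ℕ → ℕ → ℕ → ℕ → ℕ → Set
  VPer A k l h w r = Per (RowEq A k l w) h r

  VPer-multiple : ∀ (A : Array Σ) k l {h w r} → VPer A k l h w r → ∀ x {a b} → a + x * r < h → b < w →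
    A (k + a) (l + b) ≡ A (k + (a + x * r)) (l + b)
  VPer-multiple A k l {w = w} P x {a} lt b<w = Periods.Per-multiple (RowEq-equiv A k l w) P x a lt b<w

  VPer-narrow : ∀ (A : Array Σ) k l {h w w′ r} → w ≤ w′ → VPer A k l h w′ r → VPer A k l h w r
  VPer-narrow A k l w≤w′ P a lt b<w = P a lt (<-≤-trans b<w w≤w′)

  SameBlock : Array Σ → (k l k′ l′ h w : ℕ) → Set
  SameBlock A k l k′ l′ h w = ∀ a b → a < h → b < w → A (k + a) (l + b) ≡ A (k′ + a) (l′ + b)

  -- The vertical part of the statement that the 2p × 2q block at (k , l) has primitive
  -- root r × s; the horizontal part is the same statement about flip A.
  record Half (n : ℕ) (A : Array Σ) (k l r s p q : ℕ) : Set where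
    field
      root-pos  : 1 ≤ r
      pos       : 1 ≤ p
      fits      : k + (p + p) ≤ n
      periodic  : VPer A k l (p + p) (q + q) r
      irreducible : ∀ {h} → h ∣ r → h < r → ¬ VPer A k l (r + r) s h

  open Half public

  -- A smaller period of the root block spreads sideways by the horizontal period `s` and downwards
  -- by `Per-extend`. Hence `irreducible` can be stated on the root block alone although the root is
  -- found from least periods of the whole block.
  spread-period : ∀ {A k l r s p q h} → 1 ≤ r → 1 ≤ s → s ≤ q → VPer A k l (p + p) (q + q) r →
    VPer (flip A) l k (q + q) (p + p) s → h ∣ r → h < r → VPer A k l (r + r) s h →
    VPer A k l (p + p) (q + q) h
  spread-period {A} {k} {l} {r} {s} {p} {q} {h} 1≤r 1≤s s≤q Pr Ps h∣r h<r Ph a lt {b} b<2q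
    with remainder s 1≤s b
  ... | b₀ , y , b₀<s , refl =
    trans (sym (VPer-multiple (flip A) l k Ps y b<2q (≤-<-trans (m≤m+n a h) lt)))
      (trans (Periods.Per-extend (RowEq-equiv A k l s) 1≤r h∣r (+-monoʳ-≤ r (<⇒≤ h<r)) Ph
                (VPer-narrow A k l (≤-trans s≤q (m≤m+n q q)) Pr) a lt b₀<s)
        (VPer-multiple (flip A) l k Ps y b<2q lt))

  transfer-half : ∀ {n A k l r s p q k′ l′} → r ≤ p → s ≤ q → Half n A k l r s p q →
    SameBlock A k l k′ l′ (r + r) (s + s) → k′ + (r + r) ≤ n → Half n A k′ l′ r s r s
  transfer-half {A = A} {k} {l} {r} {s} {p} {q} {k′} {l′} r≤p s≤q H same fits′ = record
    { root-pos = root-pos H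
    ; pos = root-pos H
    ; fits = fits′
    ; periodic = λ a lt {b} b<2s →
        trans (sym (same a b (≤-<-trans (m≤m+n a r) lt) b<2s))
          (trans (periodic H a (<-≤-trans lt (+-mono-≤ r≤p r≤p)) (<-≤-trans b<2s (+-mono-≤ s≤q s≤q)))
            (same (a + r) b lt b<2s))
    ; irreducible = λ {h} h∣r h<r P → irreducible H h∣r h<r λ a lt {b} b<s →
        let b<2s = <-≤-trans b<s (m≤m+n s s) in
        trans (same a b (≤-<-trans (m≤m+n a h) lt) b<2s)
          (trans (P a lt b<s) (sym (same (a + h) b lt b<2s)))
    }

  -- The strip of width `s₁` at the common corner lies in all three blocks, and its string of rows
  -- begins with three squares. The bound `r₃ ≤ r₁ + r₁` brings them under `three-squares`, whose
  -- period contradicts `irreducible` of the first block, stated for exactly this width.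
  no-three-halves : ∀ {n A k l r₁ r₂ r₃ s₁ s₂ s₃} →
    Half n A k l r₁ s₁ r₁ s₁ → Half n A k l r₂ s₂ r₂ s₂ → Half n A k l r₃ s₃ r₃ s₃ →
    r₁ < r₂ → r₂ < r₃ → r₃ ≤ r₁ + r₁ → s₁ ≤ s₂ + s₂ → s₁ ≤ s₃ + s₃ → ⊥
  no-three-halves {A = A} {k} {l} {r₁} {r₂} {r₃} {s₁} H₁ H₂ H₃ r₁<r₂ r₂<r₃ r₃≤2r₁ s₁≤2s₂ s₁≤2s₃ =
    let (g , g∣r₁ , g<r₁ , Pg) = three-squares (RowEq-equiv A k l s₁) (m<n⇒0<n∸m r₁<r₂) (m<n⇒0<n∸m r₂<r₃)
          (+-cancelˡ-≤ r₁ _ _ (subst (_≤ r₁ + r₁) (trans (sym eq₃) (+-assoc r₁ _ _)) r₃≤2r₁))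
          (VPer-narrow A k l (m≤m+n s₁ s₁) (periodic H₁))
          (subst Sq (sym eq₂) (VPer-narrow A k l s₁≤2s₂ (periodic H₂)))
          (subst Sq (sym eq₃) (VPer-narrow A k l s₁≤2s₃ (periodic H₃)))
    in irreducible H₁ g∣r₁ g<r₁ Pg
    where
      Sq = λ r → VPer A k l (r + r) s₁ r
      eq₂ : r₁ + (r₂ ∸ r₁) ≡ r₂
      eq₂ = m+[n∸m]≡n (<⇒≤ r₁<r₂)
      eq₃ : r₁ + (r₂ ∸ r₁) + (r₃ ∸ r₂) ≡ r₃
      eq₃ = trans (cong (_+ (r₃ ∸ r₂)) eq₂) (m+[n∸m]≡n (<⇒≤ r₂<r₃))

  lower-half : ∀ q {x} → x < q + q → ¬ x < q → ∃[ b ] b < q × x ≡ q + b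
  lower-half q {x} x<2q x≮q =
    x ∸ q , +-cancelˡ-< q _ _ (subst (_< q + q) (sym eq) x<2q) , sym eq
    where
      eq : q + (x ∸ q) ≡ x
      eq = m+[n∸m]≡n (≮⇒≥ x≮q)

  private
    shift-eq : ∀ i p a → i + p + a ≡ i + (a + p)
    shift-eq = solve-∀

  quartic-vertical : ∀ {n} {A : Array Σ} {i j p q} → IsQuarticOcc n A (occ i j p q) → VPer A i j (p + p) (q + q) p
  quartic-vertical {A = A} {i} {j} {p} {q} (_ , _ , _ , _ , e) a lt {b} b<2q with +-cancelʳ-< p a p lt | b <? q
  ... | a<p | yes b<q = trans (proj₁ (e a b a<p b<q)) (cong (λ z → A z (j + b)) (shift-eq i p a))
  ... | a<p | no b≮q with lower-half q b<2q b≮q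
  ... | b′ , b′<q , refl =
    subst₂ (λ y z → A (i + a) y ≡ A z y) (+-assoc j q b′) (shift-eq i p a)
      (trans (sym (proj₁ (proj₂ (e a b′ a<p b′<q)))) (proj₂ (proj₂ (e a b′ a<p b′<q))))

  flip-quartic : ∀ {n} {A : Array Σ} {i j p q} → IsQuarticOcc n A (occ i j p q) → IsQuarticOcc n (flip A) (occ j i q p)
  flip-quartic (1≤p , 1≤q , fit , fit′ , e) = 1≤q , 1≤p , fit′ , fit , λ b a b< a< →
    let (e₁ , e₂ , e₃) = e a b a< b< in e₂ , e₁ , e₃

-- Counting primitive quartics, then all quartics

1+log≤ : ∀ {r n} → 1 ≤ r → r + r ≤ n → 1 + ⌈log₂ r ⌉ ≤ ⌈log₂ n ⌉
1+log≤ {r} {n} 1≤r 2r≤n = subst (_≤ ⌈log₂ n ⌉) (⌈log₂2*n⌉≡1+⌈log₂n⌉ r)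
  (⌈log₂⌉-mono-≤ (subst (_≤ n) (cong (r +_) (sym (+-identityʳ r))) 2r≤n))
  where instance _ = >-nonZero 1≤r

-- More than doubling `r` would raise the rounded logarithm, so members of one dyadic class differ
-- by a factor of at most two.
same-log : ∀ {r r′} → 1 ≤ r → ⌈log₂ r ⌉ ≡ ⌈log₂ r′ ⌉ → r′ ≤ r + r
same-log {r} {r′} 1≤r eq with r′ ≤? r + r
... | yes le = le
... | no nle = contradiction (subst (_≤ ⌈log₂ r′ ⌉) (cong suc eq) (1+log≤ 1≤r (<⇒≤ (≰⇒> nle)))) 1+n≰n

module _ {Σ : Set} (n : ℕ) (A : Array Σ) where

  Primitive : Occ → Set
  Primitive o = Half n A (row o) (col o) (p o) (q o) (p o) (q o)
              × Half n (flip A) (col o) (row o) (q o) (p o) (q o) (p o)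

  -- The factors count, from left to right, rows, columns, dyadic classes of heights and of widths,
  -- two heights in a class, two widths for each height, and one occurrence once all four
  -- coordinates are fixed.
  at-most-primitive : AtMost _≢_ Primitive (n * (n * (⌈log₂ n ⌉ * (⌈log₂ n ⌉ * (2 * (2 * 1))))))
  at-most-primitive =
    at-most-fibres row n (λ (V , H) → corner V) λ _ →
    at-most-fibres col n (λ ((V , H) , _) → corner H) λ _ →
    at-most-fibres (⌈log₂_⌉ ∘ p) _ (λ (((V , H) , _) , _) → size V) λ _ →
    at-most-fibres (⌈log₂_⌉ ∘ q) _ (λ ((((V , H) , _) , _) , _) → size H) λ _ →
    at-most-two-values p (λ {x} {y} {z} → no-three-heights {x} {y} {z}) λ _ →
    at-most-two-values q (λ (X , _) (Y , _) (Z , _) → no-three-widths X Y Z) λ _ →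
    at-most-one (λ ((((((_ , k≡) , l≡) , _) , _) , r≡) , s≡) ((((((_ , k≡′) , l≡′) , _) , _) , r≡′) , s≡′) neq →
      neq (occ-≡ (trans k≡ (sym k≡′)) (trans l≡ (sym l≡′)) (trans r≡ (sym r≡′)) (trans s≡ (sym s≡′))))
    where
      occ-≡ : ∀ {o o′} → row o ≡ row o′ → col o ≡ col o′ → p o ≡ p o′ → q o ≡ q o′ → o ≡ o′
      occ-≡ refl refl refl refl = refl
      corner : ∀ {B : Array Σ} {k l r s} → Half n B k l r s r s → k < n
      corner {k = k} {r = r} V = <-≤-trans (m<m+n k (≤-trans (root-pos V) (m≤m+n r r))) (fits V)
      size : ∀ {B : Array Σ} {k l r s} → Half n B k l r s r s → ⌈log₂ r ⌉ < ⌈log₂ n ⌉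
      size {k = k} V = 1+log≤ (root-pos V) (≤-trans (m≤n+m _ k) (fits V))
      Class : (k l a b : ℕ) → Occ → Set
      Class k l a b o = (((Primitive o × row o ≡ k) × col o ≡ l) × ⌈log₂ p o ⌉ ≡ a) × ⌈log₂ q o ⌉ ≡ b
      no-three-heights : ∀ {x y z k l a b} → Class k l a b x → Class k l a b y → Class k l a b z →
        p x < p y → p y < p z → ⊥
      no-three-heights
        ((((X , refl) , refl) , ax) , bx) ((((Y , refl) , refl) , ay) , by) ((((Z , refl) , refl) , az) , bz) x<y y<z =
        no-three-halves (proj₁ X) (proj₁ Y) (proj₁ Z) x<y y<z
          -- The height class bounds the largest height by twice the smallest; the width class makes
          -- the strip of width `q x` fit into the other two blocks.
          (same-log (root-pos (proj₁ X)) (trans ax (sym az)))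
          (same-log (root-pos (proj₂ Y)) (trans by (sym bx)))
          (same-log (root-pos (proj₂ Z)) (trans bz (sym bx)))
      no-three-widths : ∀ {x y z k l a b} → Class k l a b x → Class k l a b y → Class k l a b z →
        q x < q y → q y < q z → ⊥
      no-three-widths
        ((((X , refl) , refl) , ax) , bx) ((((Y , refl) , refl) , ay) , by) ((((Z , refl) , refl) , az) , bz) x<y y<z =
        no-three-halves (proj₂ X) (proj₂ Y) (proj₂ Z) x<y y<z
          (same-log (root-pos (proj₂ X)) (trans bx (sym bz)))
          (same-log (root-pos (proj₁ Y)) (trans ay (sym ax)))
          (same-log (root-pos (proj₁ Z)) (trans az (sym ax)))

  -- A quartic presented as W^{2α,2β}, with W the primitive `r` × `s` block at its corner. `base` is
  -- the corner W^{2,2}, and `tile x y` is its translate by `x` roots down and `y` roots right.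
  record Rooted : Set where
    field
      k l r s α β : ℕ
      vertical   : Half n A k l r s (α * r) (β * s)
      horizontal : Half n (flip A) l k s r (β * s) (α * r)

    whole base : Occ
    whole = occ k l (α * r) (β * s)
    base  = occ k l r s

    tile : ℕ → ℕ → Occ
    tile x y = occ (k + x * r) (l + y * s) r s

    α-pos : 1 ≤ α
    α-pos = factor-pos α (pos vertical)
      where
        factor-pos : ∀ m → 1 ≤ m * r → 1 ≤ m
        factor-pos (suc m) _ = s≤s z≤n

    β-pos : 1 ≤ β
    β-pos = factor-pos β (pos horizontal)
      where
        factor-pos : ∀ m → 1 ≤ m * s → 1 ≤ m
        factor-pos (suc m) _ = s≤s z≤n

    tiled : ∀ {x y a b} → a + x * r < α * r + α * r → b + y * s < β * s + β * s →
      A (k + a) (l + b) ≡ A (k + (a + x * r)) (l + (b + y * s))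
    tiled {x} {y} {a} {b} lt lt′ =
      trans (VPer-multiple A k l (periodic vertical) x lt (≤-<-trans (m≤m+n b (y * s)) lt′))
        (VPer-multiple (flip A) l k (periodic horizontal) y lt′ lt)

    tile-content : ∀ {x y} → x < α → y < β → SameContent A base (tile x y)
    tile-content {x} {y} x<α y<β = refl , refl , λ a b a<2r b<2s →
      trans (tiled {x} {y} (multiple-fits x<α r a<2r) (multiple-fits y<β s b<2s))
        (cong₂ A (eq k a (x * r)) (eq l b (y * s)))
      where
        eq : ∀ k a y → k + (a + y) ≡ k + y + a
        eq = solve-∀

    tile-primitive : ∀ {x y} → x < α → y < β → Primitive (tile x y)
    tile-primitive {x} {y} x<α y<β =
      transfer-half {A = A} r≤ s≤ vertical content (tile-fits k r x<α (fits vertical)) ,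
      transfer-half {A = flip A} s≤ r≤ horizontal (λ b a b< a< → content a b a< b<) (tile-fits l s y<β (fits horizontal))
      where
        content = proj₂ (proj₂ (tile-content x<α y<β))
        r≤ : r ≤ α * r
        r≤ = ≤-trans (m≤m+n r (x * r)) (*-monoˡ-≤ r x<α)
        s≤ : s ≤ β * s
        s≤ = ≤-trans (m≤m+n s (y * s)) (*-monoˡ-≤ s y<β)
        tile-fits : ∀ i c {z m} → z < m → i + (m * c + m * c) ≤ n → i + z * c + (c + c) ≤ n
        tile-fits i c {z} {m} z<m = ≤-trans (subst (_≤ i + (m * c + m * c)) (eq i c (z * c))
          (+-monoʳ-≤ i (+-mono-≤ (*-monoˡ-≤ c z<m) (≤-trans (m≤m+n c (z * c)) (*-monoˡ-≤ c z<m)))))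
          where
            eq : ∀ i c y → i + (c + y + c) ≡ i + y + (c + c)
            eq = solve-∀

  open Rooted using (whole; base; tile; vertical; horizontal)
  open Rooted using (α; β)

  Same-sym : ∀ {o o′} → SameContent A o o′ → SameContent A o′ o
  Same-sym (refl , refl , e) = refl , refl , λ a b a< b< → sym (e a b a< b<)

  Same-trans : ∀ {o o′ o″} → SameContent A o o′ → SameContent A o′ o″ → SameContent A o o″
  Same-trans (refl , refl , e) (refl , refl , f) = refl , refl , λ a b a< b< → trans (e a b a< b<) (f a b a< b<)

  -- The periods carry each entry back into the corner copy of the root, so the content of the root
  -- and the two exponents determine the block.
  Same-whole : ∀ u v → SameContent A (base u) (base v) → α u ≡ α v → β u ≡ β v →
    SameContent A (whole u) (whole v)
  Same-whole u@record { r = r ; s = s } v (refl , refl , e) refl refl = refl , refl , same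
    where
      same : ∀ a b → a < α u * r + α u * r → b < β u * s + β u * s → _
      same a b a< b< with remainder r (root-pos (vertical u)) a | remainder s (root-pos (horizontal u)) b
      ... | a₀ , x , a₀<r , refl | b₀ , y , b₀<s , refl =
        trans (sym (Rooted.tiled u {x} {y} a< b<))
          (trans (e a₀ b₀ (<-≤-trans a₀<r (m≤m+n r r)) (<-≤-trans b₀<s (m≤m+n s s)))
            (Rooted.tiled v {x} {y} a< b<))

  -- Minimality ranges over the divisors of `p`: the root then divides the block evenly, and every
  -- proper divisor of `r` is again a competitor.
  LeastPeriod : Array Σ → (i j p q r : ℕ) → Set
  LeastPeriod B i j p q r = (r ∣ p × VPer B i j (p + p) (q + q) r) ×
    (∀ {h} → h < r → ¬ (h ∣ p × VPer B i j (p + p) (q + q) h))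

  least-half : ∀ {B i j p q r s} → 1 ≤ p → 1 ≤ q → i + (p + p) ≤ n →
    LeastPeriod B i j p q r → LeastPeriod (flip B) j i q p s → Half n B i j r s p q
  least-half {B} {i} {j} {p} {q} {r} {s} 1≤p 1≤q fit ((r∣p , Pr) , least) ((s∣q , Ps) , _) = record
    { root-pos = 1≤r
    ; pos = 1≤p
    ; fits = fit
    ; periodic = Pr
    ; irreducible = λ {h} h∣r h<r Ph → least h<r (∣-trans h∣r r∣p ,
        spread-period {A = B} {i} {j} {p = p} 1≤r (divisor-pos 1≤q s∣q) (divisor-≤ 1≤q s∣q) Pr Ps h∣r h<r Ph)
    }
    where
      1≤r : 1 ≤ r
      1≤r = divisor-pos 1≤p r∣p


  -- Equality of letters is not decidable, so roots and content classes are only found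
  -- under a double negation, which is removed from the final inequality between numbers.
  primitive-root : ∀ {o} → IsQuarticOcc n A o → ¬ ¬ (∃[ u ] whole u ≡ o)
  primitive-root {occ i j p q} Q@(1≤p , 1≤q , fit , fit′ , _) k =
    ¬¬-least {λ r → r ∣ p × VPer A i j (p + p) (q + q) r}
      (∣-refl , quartic-vertical {A = A} {i} {j} Q) λ (r , Pr , least-r) →
    ¬¬-least {λ s → s ∣ q × VPer (flip A) j i (q + q) (p + p) s}
      (∣-refl , quartic-vertical {A = flip A} {j} {i} (flip-quartic {A = A} {i} {j} Q)) λ (s , Ps , least-s) →
    k (build Pr Ps (least-half {A} {i} {j} 1≤p 1≤q fit (Pr , least-r) (Ps , least-s))
                   (least-half {flip A} {j} {i} 1≤q 1≤p fit′ (Ps , least-s) (Pr , least-r)))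
    where
      build : ∀ {r s} {X Y : Set} → r ∣ p × X → s ∣ q × Y →
        Half n A i j r s p q → Half n (flip A) j i s r q p → ∃[ u ] whole u ≡ occ i j p q
      build {r} {s} (divides α refl , _) (divides β refl , _) V H = record
        { k = i ; l = j ; r = r ; s = s ; α = α ; β = β ; vertical = V ; horizontal = H } , refl

  primitive-roots : ∀ {qs} → All (IsQuarticOcc n A) qs → ¬ ¬ (∃[ us ] map whole us ≡ qs)
  primitive-roots [] k = k ([] , refl)
  primitive-roots (Q ∷ Qs) k = primitive-root Q λ (u , eq) → primitive-roots Qs λ (us , eqs) →
    k (u ∷ us , cong₂ _∷_ eq eqs)

  -- Powers of a fixed root and their tiles

  Distinct : Rooted → Rooted → Set
  Distinct u v = ¬ SameContent A (whole u) (whole v)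

  multiples-injective : ∀ i {c x x′} → 1 ≤ c → i + x * c ≡ i + x′ * c → x ≡ x′
  multiples-injective i {c} {x} {x′} 1≤c eq = *-cancelʳ-≡ x x′ c (+-cancelˡ-≡ i _ _ eq)
    where instance _ = >-nonZero 1≤c

  HasRoot : Occ → ℕ → Rooted → Set
  HasRoot w a u = SameContent A w (base u) × α u ≡ a

  distinct-widths : ∀ {w a b} us → AllPairs Distinct us → All (HasRoot w a) us →
    All (λ u → β u ≤ b) us → length us ≤ b
  distinct-widths {w} {a} {b} us rs ps βs = subst (length us ≤_) (*-identityʳ b)
    (at-most-fibres
      {P = λ t → HasRoot w a t × β t ≤ b}
      -- The exponents `β` lie in 1, ..., `b`; the shift by one makes them `b` values starting from
      -- 0, and stays injective because `β` is positive.
      (λ t → β t ∸ 1) b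
      (λ {t} (_ , β≤) → <-≤-trans (≤-reflexive (m+[n∸m]≡n (Rooted.β-pos t))) β≤)
      (λ c → at-most-one λ {t} {t′} (((same , αt) , _) , βt) (((same′ , αt′) , _) , βt′) distinct →
        distinct (Same-whole t t′ (Same-trans (Same-sym same) same′) (trans αt (sym αt′))
          (∸-cancelʳ-≡ (Rooted.β-pos t) (Rooted.β-pos t′) (trans βt (sym βt′)))))
      us rs (All.zip (ps , βs)))

  TilesInRow : Occ → ℕ → ℕ → Set
  TilesInRow w i b = ∃[ os ] AllPairs _≢_ os × All Primitive os × All (SameContent A w) os ×
    All (λ o → row o ≡ i) os × length os ≡ b

  tiles-in-row : ∀ {w} v x → x < α v → SameContent A w (base v) →
    TilesInRow w (row (tile v x 0)) (β v)
  tiles-in-row v x x<α same =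
    applyUpTo (tile v x) (β v) ,
    AllPairs.applyUpTo⁺₁ (tile v x) (β v)
      (λ y<y′ _ eq → <⇒≢ y<y′
        (multiples-injective (Rooted.l v) (root-pos (horizontal v)) (cong col eq))) ,
    All.applyUpTo⁺₁ (tile v x) (β v) (λ y<β → Rooted.tile-primitive v x<α y<β) ,
    All.applyUpTo⁺₁ (tile v x) (β v)
      (λ y<β → Same-trans same (Rooted.tile-content v x<α y<β)) ,
    All.applyUpTo⁺₂ (tile v x) (β v) (λ _ → refl) ,
    length-applyUpTo (tile v x) (β v)

  widest : ∀ {P : Rooted → Set} u us → All P (u ∷ us) → ∃[ v ] P v × All (λ t → β t ≤ β v) (u ∷ us)
  widest u us ps = argmax β u (u ∷ us) , argmax-all β (All.head ps) ps , f[xs]≤f[argmax] u (u ∷ us)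

  -- The widest member has tiles starting in `m + 1` rows, one of which is missing from `rows`. That
  -- row carries as many tiles as the largest `β`, and this bounds the number of members, since with
  -- equal roots and equal `α` they differ in `β`.
  tiles-in-fresh-row : ∀ {w m} rows → length rows ≤ m → ∀ us → AllPairs Distinct us →
    All (HasRoot w (suc m)) us → us ≡ [] ⊎ (∃₂ λ i b → TilesInRow w i b × i ∉ rows × length us ≤ b)
  tiles-in-fresh-row rows rows≤ [] _ _ = inj₁ refl
  tiles-in-fresh-row {w} {m} rows rows≤ (u ∷ us) rs ps =
    let (v , (same , α≡) , βs) = widest u us ps
        (x , x≤m , fresh) = fresh-value (λ x → row (tile v x 0))
          (λ x<x′ eq → <⇒≢ x<x′ (multiples-injective (Rooted.k v) (root-pos (vertical v)) eq)) rows rows≤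
    in inj₂ (row (tile v x 0) , β v ,
             tiles-in-row v x (subst (x <_) (sym α≡) (s≤s x≤m)) same ,
             fresh , distinct-widths (u ∷ us) rs ps βs)

  -- `rows` records the rows already used. Each value of `α` up to `m` contributes at most one, so
  -- there are at most `m`, which leaves a fresh row for `α` equal to `m + 1`.
  TilesInRows : Occ → ℕ → ℕ → Set
  TilesInRows w m b = ∃₂ λ os rows → AllPairs _≢_ os × All Primitive os × All (SameContent A w) os ×
    All (λ o → row o ∈ rows) os × length rows ≤ m × b ≤ length os

  add-row : ∀ {w i a m b} (T : TilesInRows w m b) → TilesInRow w i a → i ∉ proj₁ (proj₂ T) →
    TilesInRows w (suc m) (a + b)
  add-row {i = i} (os , rows , os! , prims , sames , in-rows , rows≤ , b≤)
      (os′ , os′! , prims′ , sames′ , in-i , refl) i∉rows =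
    os′ ++ os , i ∷ rows ,
    AllPairs.++⁺ os′! os! (All.map (λ eq → All.map (differ eq) in-rows) in-i) ,
    All.++⁺ prims′ prims , All.++⁺ sames′ sames ,
    All.++⁺ (All.map here in-i) (All.map there in-rows) ,
    s≤s rows≤ ,
    subst (_ ≤_) (sym (length-++ os′)) (+-monoʳ-≤ (length os′) b≤)
    where
      differ : ∀ {o o′} → row o ≡ i → row o′ ∈ rows → o ≢ o′
      differ eq ∈rows refl = i∉rows (subst (_∈ rows) eq ∈rows)

  weaken-rows : ∀ {w m m′ b b′} → m ≤ m′ → b′ ≤ b → TilesInRows w m b → TilesInRows w m′ b′
  weaken-rows m≤m′ b′≤b (os , rows , os! , prims , sames , in-rows , rows≤ , b≤) =
    os , rows , os! , prims , sames , in-rows , ≤-trans rows≤ m≤m′ , ≤-trans b′≤b b≤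

  tiles-with-root : ∀ {w} m us → AllPairs Distinct us → All (λ u → SameContent A w (base u)) us →
    All (λ u → α u ≤ m) us → TilesInRows w m (length us)
  tiles-with-root zero [] _ _ _ = [] , [] , [] , [] , [] , [] , z≤n , z≤n
  tiles-with-root zero (u ∷ _) _ _ (α≤0 ∷ _) = contradiction (≤-trans (Rooted.α-pos u) α≤0) λ ()
  tiles-with-root {w} (suc m) us rs same α≤ = step (split (All.universal (λ u → α u ≟ suc m) us))
    where
      step : Split (λ u → α u ≡ suc m) us → TilesInRows w (suc m) (length us)
      step (ys , zs , τ , υ , eqs , neqs , len) = extend
        (tiles-with-root m zs (AllPairs-resp-⊆ υ rs) (All-resp-⊆ υ same)
          (All.zipWith (λ (le , neq) → ≤-pred (≤∧≢⇒< le neq)) (All-resp-⊆ υ α≤ , neqs)))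
        where
          extend : TilesInRows w m (length zs) → TilesInRows w (suc m) (length us)
          extend T@(_ , rows , _ , _ , _ , _ , rows≤ , _) =
            [ (λ { refl → weaken-rows (n≤1+n m) (≤-reflexive len) T })
            , (λ (i , b , R , i∉rows , ys≤) →
                weaken-rows ≤-refl (subst (_≤ b + length zs) (sym len) (+-monoˡ-≤ (length zs) ys≤))
                  (add-row T R i∉rows))
            ]′ (tiles-in-fresh-row rows rows≤ ys (AllPairs-resp-⊆ τ rs) (All.zip (All-resp-⊆ τ same , eqs)))

  α≤n : ∀ u → α u ≤ n
  α≤n u = ≤-trans (m≤m*n (α u) (Rooted.r u)) (≤-trans (m≤m+n _ _) (≤-trans (m≤n+m _ (Rooted.k u)) (fits (vertical u))))
    where instance _ = >-nonZero (root-pos (vertical u))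

  -- The classes of equal root content are treated one after another, `m` bounding the recursion.
  -- `Q` collects the conditions of differing from the earlier roots; it is passed from roots to
  -- their tiles, so tiles of different classes never coincide.
  primitive-tiles : ∀ m us → length us ≤ m → (Q : Occ → Set) → (∀ {o o′} → SameContent A o o′ → Q o → Q o′) →
    AllPairs Distinct us → All (Q ∘ base) us →
    ¬ ¬ (∃[ os ] AllPairs _≢_ os × All Primitive os × All Q os × length us ≤ length os)
  primitive-tiles m [] _ _ _ _ _ k = k ([] , [] , [] , [] , z≤n)
  primitive-tiles (suc m) (u ∷ us) (s≤s len≤m) Q resp (r ∷ rs) (Qu ∷ Qs) k =
    ¬¬-All (λ v → ¬¬-excluded-middle {A = SameContent A w (base v)}) us λ same? → rest (split same?)
    where
      w : Occ
      w = base u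
      rest : ¬ Split (λ v → SameContent A w (base v)) us
      rest (ys , zs , τ , υ , same , other , len)
        with tiles-with-root n (u ∷ ys) (All-resp-⊆ τ r ∷ AllPairs-resp-⊆ τ rs)
               ((refl , refl , λ _ _ _ _ → refl) ∷ same) (All.universal α≤n (u ∷ ys))
      ... | os , _ , os! , prims , sames , _ , _ , ys≤ =
        primitive-tiles m zs (≤-trans (m≤n+m _ (length ys)) (≤-trans (≤-reflexive (sym len)) len≤m))
          (λ o → Q o × ¬ SameContent A w o)
          (λ s (Qo , w≁o) → resp s Qo , λ w∼o′ → w≁o (Same-trans w∼o′ (Same-sym s)))
          (AllPairs-resp-⊆ υ rs) (All.zip (All-resp-⊆ υ Qs , other))
          λ (os′ , os′! , prims′ , Qs′ , zs≤) →
        k (os ++ os′ ,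
           AllPairs.++⁺ os! os′!
             (All.map (λ w∼o → All.map (λ { (_ , w≁o) refl → w≁o w∼o }) Qs′) sames) ,
           All.++⁺ prims prims′ ,
           All.++⁺ (All.map (λ w∼o → resp w∼o Qu) sames) (All.map proj₁ Qs′) ,
           subst₂ _≤_ (cong suc (sym len)) (sym (length-++ os)) (+-mono-≤ ys≤ zs≤))

  count-quartics : ∀ qs → All (IsQuarticOcc n A) qs → AllPairs (λ o o′ → ¬ SameContent A o o′) qs →
    length qs ≤ 4 * (n * n) * (⌈log₂ n ⌉ * ⌈log₂ n ⌉)
  count-quartics qs Qs distinct =
    subst (length qs ≤_) (rearrange n ⌈log₂ n ⌉) (decidable-stable (length qs ≤? bound) λ k →
      primitive-roots Qs λ (us , eq) →
      -- No class has been treated at the start, so the invariant begins as the trivial one.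
      primitive-tiles (length us) us ≤-refl (λ _ → ⊤) (λ _ _ → tt)
        (AllPairs.map⁻ (subst (AllPairs (λ o o′ → ¬ SameContent A o o′)) (sym eq) distinct))
        (All.universal (λ _ → tt) us)
        λ (os , os! , prims , _ , us≤) →
      k (subst (_≤ bound) (trans (sym (length-map whole us)) (cong length eq))
          (≤-trans us≤ (at-most-primitive os os! prims))))
    where
      bound : ℕ
      bound = n * (n * (⌈log₂ n ⌉ * (⌈log₂ n ⌉ * (2 * (2 * 1)))))
      rearrange : ∀ n l → n * (n * (l * (l * (2 * (2 * 1))))) ≡ 4 * (n * n) * (l * l)
      rearrange = solve-∀

theorem15 : ∃[ C ] (∀ (n : ℕ) → 2 ≤ n → (Alph : Set) (A : Array Alph)
    (qs : List Occ) → All (IsQuarticOcc n A) qs →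
    AllPairs (λ o o′ → ¬ SameContent A o o′) qs →
    length qs ≤ C * (n * n) * (⌈log₂ n ⌉ * ⌈log₂ n ⌉))
theorem15 = 4 , λ n _ Alph A qs quartics distinct → count-quartics n A qs quartics distinct
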